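{- For all $m\ge 3$, the Sperner systems $\mathcal{U}^{2m+1}_1$ and $\mathcal{U}^{2m+1}_2$ are strongly hypomorphic.
   Context: A set system over a finite set $A$ (the ground set) is a set of subsets of $A$, called blocks; it is a Sperner system if no block is included in another. Set systems $\mathcal A$ over $A$ and $\mathcal B$ over $B$ are isomorphic, $\mathcal A\equiv\mathcal B$, if there is a bijection $\sigma\colon A\to B$ with $\{\sigma(S):S\in\mathcal A\}=\mathcal B$. For a two-element subset $I$ of $A$, let $\theta_I$ be the equivalence relation on $A$ whose only nonsingleton class is $I$; for $S\subseteq A$ let $S_I=\{x/\theta_I:x\in S\}\subseteq A/\theta_I$; for a Sperner system $\mathcal A$ over $A$ let $\mathcal A_I=\{S_I:S\in\mathcal A\}$ and let $\mathcal A^*_I$ be the set of inclusion-minimal elements of $\mathcal A_I$, a Sperner system over $A/\theta_I$. Two Sperner systems $\mathcal A,\mathcal B$ over the same ground set $A$ are strongly hypomorphic if $\mathcal A^*_I\equiv\mathcal B^*_I$ for every two-element subset $I$ of $A$. Let $[m]=\{1,\dots,m\}$. For each $n\in[m]$ let $n'$ be a new element (a primed copy of $n$), and $S'=\{n':n\in S\}$ for $S\subseteq[m]$. Let $E_m=[m]\cup[m]'$, a set with $2m$ elements. Addition of elements of $[m]$ is modulo $m$ with result taken in $[m]$. For $J\subseteq[m]$ let $F^m_J=J\cup([m]\setminus J)'$. Put $\mathcal F^m_1=\{F^m_J: J\subseteq[m],\ |J|\text{ odd}\}$ and $\mathcal F^m_2=\{F^m_J: J\subseteq[m],\ |J|\text{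 even}\}$. For $p\in[m]$ let $G^m_p=E_m\setminus\{p,p',(p+1)'\}$ and $\mathcal G^m=\{G^m_p:p\in[m]\}$. For $i\in\{1,2\}$, $\mathcal M^m_i=\mathcal F^m_i\cup\mathcal G^m$, a Sperner system over $E_m$. Let $0$ be a further element not in $E_m$. For $m\ge3$ and $i\in\{1,2\}$, $\mathcal U^{2m+1}_i=\{S\cup\{0\}:S\in\mathcal M^m_i\}$, a Sperner system over $E_m\cup\{0\}$. -}

module Defs where

open import Level using (0ℓ; Lift; lift)
open import Data.Fin.Base using (Fin; zero; suc; toℕ)
open import Data.Fin.Properties using (_≟_)
import Data.Fin.Subset as Fin
import Data.Fin.Subset.Properties as Fin
open import Data.Maybe.Base using (Maybe; just; nothing; maybe)
open import Data.Nat.Base using (ℕ; suc; _+_; _≤_; s≤s; z≤n; parity)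
open import Data.Nat.DivMod using (_mod_)
open import Data.Parity.Base using (Parity; 0ℙ; 1ℙ)
open import Data.Product.Base using (Σ-syntax; ∃-syntax; ∃₂; _×_; _,_; proj₁; proj₂)
open import Data.Sum.Base using (_⊎_; inj₁; inj₂; [_,_])
open import Data.Unit.Base using (⊤)
open import Function.Base using (id)
open import Function.Bundles using (Func; Injection; Bijection)
open import Relation.Binary.Bundles using (Setoid)
open import Relation.Binary.Definitions using (_Respects_)
open import Relation.Binary.PropositionalEquality using (_≡_; _≢_; refl; subst; setoid)
open import Relation.Nullary using (¬_; yes; no; contradiction)
open import Relation.Unary using (Pred; _⊆_; _≐_; _∪_)
open import Relation.Unary.Properties using (≐-refl; ≐-sym; ≐-trans)

-- Ground sets are setoids, so that A / θ_I is again a ground set: the same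
-- carrier with a coarser equality.  The general notions do not need the ground
-- set to be finite, so this is not required.

record Subset (X : Setoid 0ℓ 0ℓ) : Set₁ where
  open Setoid X using (Carrier; _≈_)
  field
    ⟦_⟧  : Pred Carrier 0ℓ
    resp : ⟦_⟧ Respects _≈_

open Subset public using (⟦_⟧)

-- Equality of subsets is _≐_ (same elements), hence the closure condition on a
-- set of subsets.

record SetSystem (X : Setoid 0ℓ 0ℓ) : Set₂ where
  field
    Block : Pred (Subset X) (Level.suc 0ℓ)
    resp  : ∀ {S T} → ⟦ S ⟧ ≐ ⟦ T ⟧ → Block S → Block T

open SetSystem public using (Block)

IsSperner : ∀ {X} → SetSystem X → Set₁
IsSperner 𝒜 = ∀ {S T} → Block 𝒜 S → Block 𝒜 T → ⟦ S ⟧ ⊆ ⟦ T ⟧ → ⟦ S ⟧ ≐ ⟦ T ⟧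

record SpernerSystem (X : Setoid 0ℓ 0ℓ) : Set₂ where
  field
    system    : SetSystem X
    isSperner : IsSperner system

open SpernerSystem public using (system)

-- { S a : a ∈ A }
family : ∀ {X} {A : Set} → (A → Subset X) → SetSystem X
family S = record
  { Block = λ T → Lift _ (∃[ a ] ⟦ T ⟧ ≐ ⟦ S a ⟧)
  ; resp  = λ T≐T′ (lift (a , T≐S)) → lift (a , ≐-trans (≐-sym T≐T′) T≐S)
  }

infixr 6 _∪ₛ_

_∪ₛ_ : ∀ {X} → SetSystem X → SetSystem X → SetSystem X
𝒜 ∪ₛ ℬ = record
  { Block = Block 𝒜 ∪ Block ℬ
  ; resp  = λ {S} {T} S≐T → [ (λ S∈𝒜 → inj₁ (SetSystem.resp 𝒜 {S} {T} S≐T S∈𝒜))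
                            , (λ S∈ℬ → inj₂ (SetSystem.resp ℬ {S} {T} S≐T S∈ℬ)) ]
  }

⊆-transfer : ∀ {A : Set} {P P′ Q Q′ : Pred A 0ℓ} → P ≐ P′ → Q ≐ Q′ →
             (P′ ⊆ Q′ → P′ ≐ Q′) → P ⊆ Q → P ≐ Q
⊆-transfer (P⊆P′ , P′⊆P) Q≐Q′@(Q⊆Q′ , _) h P⊆Q =
  ≐-trans (P⊆P′ , P′⊆P) (≐-trans (h (λ x → Q⊆Q′ (P⊆Q (P′⊆P x)))) (≐-sym Q≐Q′))

module _ {X Y : Setoid 0ℓ 0ℓ} where
  private module Y = Setoid Y

  image : Func X Y → Subset X → Subset Y
  image f S = record
    { ⟦_⟧  = λ y → ∃[ x ] ⟦ S ⟧ x × Func.to f x Y.≈ y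
    ; resp = λ y≈z (x , x∈S , fx≈y) → x , x∈S , Y.trans fx≈y y≈z
    }

  -- { f(S) : S ∈ 𝒜 }
  imageSystem : Func X Y → SetSystem X → SetSystem Y
  imageSystem f 𝒜 = record
    { Block = λ T → ∃[ S ] Block 𝒜 S × ⟦ T ⟧ ≐ ⟦ image f S ⟧
    ; resp  = λ T≐T′ (S , S∈𝒜 , T≐fS) → S , S∈𝒜 , ≐-trans (≐-sym T≐T′) T≐fS
    }

infix 4 _≅_

_≅_ : ∀ {X Y} → SetSystem X → SetSystem Y → Set₁
_≅_ {X} {Y} 𝒜 ℬ =
  Σ[ σ ∈ Bijection X Y ] Block (imageSystem (Injection.function (Bijection.injection σ)) 𝒜) ≐ Block ℬ

minimal : ∀ {X} → SetSystem X → SpernerSystem X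
minimal 𝒜 = record
  { system = record
    { Block = λ T → Block 𝒜 T × (∀ {S} → Block 𝒜 S → ⟦ S ⟧ ⊆ ⟦ T ⟧ → ⟦ S ⟧ ≐ ⟦ T ⟧)
    ; resp  = λ {S} {T} S≐T (S∈𝒜 , min) →
        SetSystem.resp 𝒜 {S} {T} S≐T S∈𝒜 ,
        λ {R} R∈𝒜 R⊆T →
          ≐-trans (min {R} R∈𝒜 (λ x∈R → proj₂ S≐T (R⊆T x∈R))) S≐T
    }
  ; isSperner = λ {S} (S∈𝒜 , _) (_ , min) S⊆T → min {S} S∈𝒜 S⊆T
  }

module _ {X : Setoid 0ℓ 0ℓ} where
  open Setoid X using (Carrier; _≈_)
  private module X = Setoid X

  IsTwoElement : Subset X → Set
  IsTwoElement I =
    ∃₂ λ a b → ¬ (a ≈ b) × ⟦ I ⟧ ≐ (λ x → x ≈ a ⊎ x ≈ b)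

  θ : Subset X → Carrier → Carrier → Set
  θ I x y = x ≈ y ⊎ (⟦ I ⟧ x × ⟦ I ⟧ y)

  θ-trans : ∀ I {x y z} → θ I x y → θ I y z → θ I x z
  θ-trans I (inj₁ x≈y)         (inj₁ y≈z)         = inj₁ (X.trans x≈y y≈z)
  θ-trans I (inj₁ x≈y)         (inj₂ (y∈I , z∈I)) = inj₂ (Subset.resp I (X.sym x≈y) y∈I , z∈I)
  θ-trans I (inj₂ (x∈I , y∈I)) (inj₁ y≈z)         = inj₂ (x∈I , Subset.resp I y≈z y∈I)
  θ-trans I (inj₂ (x∈I , _))   (inj₂ (_ , z∈I))   = inj₂ (x∈I , z∈I)

  Quotient : Subset X → Setoid 0ℓ 0ℓ
  Quotient I = record
    { Carrier       = Carrier
    ; _≈_           = θ I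
    ; isEquivalence = record
      { refl  = inj₁ X.refl
      ; sym   = λ { (inj₁ x≈y)         → inj₁ (X.sym x≈y)
                  ; (inj₂ (x∈I , y∈I)) → inj₂ (y∈I , x∈I) }
      ; trans = θ-trans I
      }
    }

  -- x ↦ x / θ_I
  quotientMap : (I : Subset X) → Func X (Quotient I)
  quotientMap I = record { to = id ; cong = inj₁ }

  -- 𝒜*_I
  contract : SpernerSystem X → (I : Subset X) → SpernerSystem (Quotient I)
  contract 𝒜 I = minimal (imageSystem (quotientMap I) (system 𝒜))

  StronglyHypomorphic : SpernerSystem X → SpernerSystem X → Set₁
  StronglyHypomorphic 𝒜 ℬ =
    ∀ I → IsTwoElement I → system (contract 𝒜 I) ≅ system (contract ℬ I)

discrete : ∀ {A : Set} → Pred A 0ℓ → Subset (setoid A)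
discrete P = record { ⟦_⟧ = P ; resp = subst P }

-- [m] is represented by the residues Fin m.  In E m, inj₁ n is n and inj₂ n is
-- its primed copy n′; in Maybe (E m), nothing is the additional element 0.

E : ℕ → Set
E m = Fin m ⊎ Fin m

-- p ↦ p + 1 modulo m
next : ∀ {m} → Fin m → Fin m
next {suc m} p = suc (toℕ p) mod suc m

F : ∀ {m} → Fin.Subset m → Subset (setoid (E m))
F J = discrete [ (λ n → n Fin.∈ J) , (λ n → n Fin.∉ J) ]

G : ∀ {m} → Fin m → Subset (setoid (E m))
G p = discrete λ x → x ≢ inj₁ p × x ≢ inj₂ p × x ≢ inj₂ (next p)

-- { F_J : J ⊆ [m], |J| has parity π }
ℱ : ∀ m → Parity → SetSystem (setoid (E m))
ℱ m π = family {A = Σ[ J ∈ Fin.Subset m ] parity Fin.∣ J ∣ ≡ π} λ (J , _) → F J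

𝒢 : ∀ m → SetSystem (setoid (E m))
𝒢 m = family {A = Fin m} G

avoid : ∀ {k} (a b : Fin (3 + k)) → ∃[ c ] c ≢ a × c ≢ b
avoid zero          zero          = suc zero , (λ ()) , (λ ())
avoid zero          (suc zero)    = suc (suc zero) , (λ ()) , (λ ())
avoid zero          (suc (suc _)) = suc zero , (λ ()) , (λ ())
avoid (suc zero)    zero          = suc (suc zero) , (λ ()) , (λ ())
avoid (suc (suc _)) zero          = suc zero , (λ ()) , (λ ())
avoid (suc _)       (suc _)       = zero , (λ ()) , (λ ())

F⊆F : ∀ {m} (J K : Fin.Subset m) → ⟦ F J ⟧ ⊆ ⟦ F K ⟧ → ⟦ F J ⟧ ≐ ⟦ F K ⟧
F⊆F J K J⊆K = (λ {x} → J⊆K {x}) , λ {x} → K⊆J x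
  where
  K⊆J : ∀ x → ⟦ F K ⟧ x → ⟦ F J ⟧ x
  K⊆J (inj₁ n) n∈K with n Fin.∈? J
  ... | yes n∈J = n∈J
  ... | no  n∉J = contradiction n∈K (J⊆K {inj₂ n} n∉J)
  K⊆J (inj₂ n) n∉K n∈J = n∉K (J⊆K {inj₁ n} n∈J)

F⊈G : ∀ {m} (J : Fin.Subset m) p → ¬ (⟦ F J ⟧ ⊆ ⟦ G p ⟧)
F⊈G J p F⊆G with p Fin.∈? J
... | yes p∈J = proj₁ (F⊆G {inj₁ p} p∈J) refl
... | no  p∉J = proj₁ (proj₂ (F⊆G {inj₂ p} p∉J)) refl

G⊈F : ∀ {m} → 3 ≤ m → (J : Fin.Subset m) → ∀ p → ¬ (⟦ G p ⟧ ⊆ ⟦ F J ⟧)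
G⊈F (s≤s (s≤s (s≤s z≤n))) J p G⊆F with avoid p (next p)
... | q , q≢p , q≢p+1 =
  G⊆F {inj₂ q} ((λ ()) , (λ { refl → q≢p refl }) , (λ { refl → q≢p+1 refl }))
      (G⊆F {inj₁ q} ((λ { refl → q≢p refl }) , (λ ()) , (λ ())))

G⊆G : ∀ {m} (p q : Fin m) → ⟦ G p ⟧ ⊆ ⟦ G q ⟧ → ⟦ G p ⟧ ≐ ⟦ G q ⟧
G⊆G p q G⊆G′ with q ≟ p
... | yes refl = ≐-refl
... | no  q≢p  = contradiction refl
  (proj₁ (G⊆G′ {inj₁ q} ((λ { refl → q≢p refl }) , (λ ()) , (λ ()))))

ℳ-isSperner : ∀ {m} → 3 ≤ m → ∀ π → IsSperner (ℱ m π ∪ₛ 𝒢 m)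
ℳ-isSperner m≥3 π (inj₁ (lift ((J , _) , S≐F))) (inj₁ (lift ((K , _) , T≐F))) =
  ⊆-transfer S≐F T≐F (F⊆F J K)
ℳ-isSperner m≥3 π (inj₁ (lift ((J , _) , S≐F))) (inj₂ (lift (p , T≐G))) =
  ⊆-transfer S≐F T≐G (λ F⊆G → contradiction (λ {x} → F⊆G {x}) (F⊈G J p))
ℳ-isSperner m≥3 π (inj₂ (lift (p , S≐G))) (inj₁ (lift ((J , _) , T≐F))) =
  ⊆-transfer S≐G T≐F (λ G⊆F → contradiction (λ {x} → G⊆F {x}) (G⊈F m≥3 J p))
ℳ-isSperner m≥3 π (inj₂ (lift (p , S≐G))) (inj₂ (lift (q , T≐G))) =
  ⊆-transfer S≐G T≐G (G⊆G p q)

ℳ : ∀ {m} → 3 ≤ m → Parity → SpernerSystem (setoid (E m))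
ℳ {m} m≥3 π = record
  { system    = ℱ m π ∪ₛ 𝒢 m
  ; isSperner = λ {S} {T} → ℳ-isSperner m≥3 π {S} {T}
  }

-- S ∪ {0}
infix 8 _∪0

_∪0 : ∀ {A} → Subset (setoid A) → Subset (setoid (Maybe A))
S ∪0 = discrete (maybe ⟦ S ⟧ ⊤)

∪0-mono : ∀ {A} (S T : Subset (setoid A)) → ⟦ S ⟧ ⊆ ⟦ T ⟧ → ⟦ S ∪0 ⟧ ⊆ ⟦ T ∪0 ⟧
∪0-mono S T S⊆T {just x}  = S⊆T
∪0-mono S T S⊆T {nothing} = id

-- { S ∪ {0} : S ∈ 𝒜 }
adjoin0 : ∀ {A} → SpernerSystem (setoid A) → SpernerSystem (setoid (Maybe A))
adjoin0 𝒜 = record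
  { system = record
    { Block = λ T → ∃[ S ] Block (system 𝒜) S × ⟦ T ⟧ ≐ ⟦ S ∪0 ⟧
    ; resp  = λ T≐T′ (S , S∈𝒜 , T≐S) → S , S∈𝒜 , ≐-trans (≐-sym T≐T′) T≐S
    }
  ; isSperner = λ (S , S∈𝒜 , S′≐) (T , T∈𝒜 , T′≐) →
      ⊆-transfer S′≐ T′≐ λ S⊆T →
        let S≐T = SpernerSystem.isSperner 𝒜 {S} {T} S∈𝒜 T∈𝒜 (λ {x} → S⊆T {just x})
        in (λ {x} → ∪0-mono S T (proj₁ S≐T) {x}) , (λ {x} → ∪0-mono T S (proj₂ S≐T) {x})
  }

-- ℱ m 1ℙ collects the F_J with |J| odd, ℱ m 0ℙ those with |J| even.
𝒰₁ 𝒰₂ : ∀ {m} → 3 ≤ m → SpernerSystem (setoid (Maybe (E m)))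
𝒰₁ m≥3 = adjoin0 (ℳ m≥3 1ℙ)
𝒰₂ m≥3 = adjoin0 (ℳ m≥3 0ℙ)

{-# OPTIONS --safe #-}
-- Exchanging q and q′ takes F_J to F_{J △ {q}}, hence exchanges ℱ₁ and ℱ₂, and it
-- fixes every G_r except G_{q-1}.  If I = {q, q′}, it is the identity modulo θ_I.
-- Otherwise I = {x, y} with x ∈ {p, p′} and y outside {p, p′, p+1, (p+1)′} for some p
-- (as m ≥ 3, this is achieved by exchanging x and y if necessary); take q = p + 1.
-- Then modulo θ_I, the block G_p contains F_J as soon as x ∈ F_J and q ∈ J, since
-- x ≡ y ∈ G_p.  Such J exist in both parities, so that G_p contributes no minimal
-- block and the exchange is the required isomorphism.
module Submission where

open import Defs
open import Level using (0ℓ; lift)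
open import Data.Bool.Base using (not; if_then_else_)
open import Data.Bool.Properties using (not-involutive)
open import Data.Fin.Base using (Fin; zero; suc; toℕ)
open import Data.Fin.Properties using (_≟_; toℕ<n; toℕ-injective; toℕ-fromℕ<)
import Data.Fin.Subset as Fin
import Data.Fin.Subset.Properties as Fin
open import Data.Maybe.Base as Maybe using (Maybe; just; nothing)
open import Data.Maybe.Properties using (just-injective)
open import Data.Nat.Base using (ℕ; suc; _≤_; _<_; s≤s; z≤n; parity)
open import Data.Nat.DivMod using (_%_; _mod_; n%n≡0; m<n⇒m%n≡m)
import Data.Nat.Properties as ℕ
open import Data.Parity.Base using (Parity; 0ℙ; 1ℙ; _⁻¹)
open import Data.Parity.Properties as ℙ using (suc-homo-⁻¹; ⁻¹-selfInverse)
open import Data.Product.Base using (∃-syntax; _×_; _,_; proj₁; proj₂)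
open import Data.Sum.Base as Sum using (_⊎_; inj₁; inj₂; [_,_])
open import Data.Unit.Base using (tt)
open import Data.Vec.Base using (_∷_; here; there; updateAt)
open import Data.Vec.Properties
  using (updateAt-minimal; updateAt-updates; updateAt-updateAt-local; updateAt-id; []=-injective)
open import Function.Base using (id; _∘_)
open import Function.Bundles using (Func)
open import Relation.Binary.Bundles using (Setoid)
open import Relation.Binary.PropositionalEquality
  using (_≡_; _≢_; refl; sym; trans; cong; subst; setoid; module ≡-Reasoning)
open import Relation.Nullary using (yes; no; does; contradiction)
open import Relation.Unary using (_⊆_; _≐_)
open import Relation.Unary.Properties using (≐-refl; ≐-sym)

-- Minimal blocks and involutions of the ground set.

module _ {Y : Setoid 0ℓ 0ℓ} (σ : Func Y Y)
         (involutive : ∀ y → Setoid._≈_ Y (Func.to σ (Func.to σ y)) y) where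
  private module Y = Setoid Y
  open Func σ renaming (cong to to-cong)

  image-mono : ∀ (S T : Subset Y) → ⟦ S ⟧ ⊆ ⟦ T ⟧ → ⟦ image σ S ⟧ ⊆ ⟦ image σ T ⟧
  image-mono _ _ S⊆T (x , x∈S , σx≈y) = x , S⊆T x∈S , σx≈y

  image-involutive : ∀ T → ⟦ image σ (image σ T) ⟧ ≐ ⟦ T ⟧
  image-involutive T =
    (λ (x , (z , z∈T , σz≈x) , σx≈y) →
      Subset.resp T (Y.trans (Y.sym (involutive z)) (Y.trans (to-cong σz≈x) σx≈y)) z∈T) ,
    λ {y} y∈T → to y , (y , y∈T , Y.refl) , involutive y

  -- Weaker than `σ` mapping 𝒜 into ℬ: a block whose image is not in ℬ is tolerated as long as a
  -- better one lies below it. Only minimal blocks matter in the end, and this leaves room for the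
  -- exceptional `G p`.
  Dominates : SetSystem Y → SetSystem Y → Set₁
  Dominates 𝒜 ℬ = ∀ T → Block 𝒜 T → ∃[ S ] Block 𝒜 S × ⟦ S ⟧ ⊆ ⟦ T ⟧ × Block ℬ (image σ S)

  -- Minimality of T forces S = T, so σT is in ℬ. If R in ℬ lies inside σT, take Q in ℬ inside R
  -- with σQ in 𝒜. Then σQ lies inside σσT = T, so σQ = T by minimality, and σT = σσQ = Q lies
  -- inside R.
  image-minimal : ∀ 𝒜 ℬ → Dominates 𝒜 ℬ → Dominates ℬ 𝒜 →
                  ∀ T → Block (system (minimal 𝒜)) T → Block (system (minimal ℬ)) (image σ T)
  image-minimal 𝒜 ℬ 𝒜≽ℬ ℬ≽𝒜 T (T∈𝒜 , min) with 𝒜≽ℬ T T∈𝒜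
  ... | S , S∈𝒜 , S⊆T , σS∈ℬ =
    SetSystem.resp ℬ {image σ S} {image σ T}
      (image-mono S T S⊆T , image-mono T S (proj₂ (min {S} S∈𝒜 S⊆T))) σS∈ℬ ,
    λ {R} R∈ℬ R⊆σT → R⊆σT , σT⊆R R R∈ℬ R⊆σT
    where
    σT⊆R : ∀ R → Block ℬ R → ⟦ R ⟧ ⊆ ⟦ image σ T ⟧ → ⟦ image σ T ⟧ ⊆ ⟦ R ⟧
    σT⊆R R R∈ℬ R⊆σT x∈σT with ℬ≽𝒜 R R∈ℬ
    ... | Q , Q∈ℬ , Q⊆R , σQ∈𝒜 =
      Q⊆R (proj₁ (image-involutive Q) (image-mono T (image σ Q) (proj₂ T≐σQ) x∈σT))
      where
      T≐σQ : ⟦ image σ Q ⟧ ≐ ⟦ T ⟧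
      T≐σQ = min {image σ Q} σQ∈𝒜
        (proj₁ (image-involutive T) ∘ image-mono Q (image σ T) (R⊆σT ∘ Q⊆R))

  minimal-≅ : ∀ 𝒜 ℬ → Dominates 𝒜 ℬ → Dominates ℬ 𝒜 →
              system (minimal 𝒜) ≅ system (minimal ℬ)
  minimal-≅ 𝒜 ℬ 𝒜≽ℬ ℬ≽𝒜 =
    record
      { to        = to
      ; cong      = to-cong
      ; bijective =
          (λ {x} {y} σx≈σy →
            Y.trans (Y.sym (involutive x)) (Y.trans (to-cong σx≈σy) (involutive y))) ,
          λ y → to y , λ z≈σy → Y.trans (to-cong z≈σy) (involutive y)
      } ,
    (λ {T} (S , S∈min , T≐σS) →
      SetSystem.resp (system (minimal ℬ)) {image σ S} {T} (≐-sym T≐σS)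
        (image-minimal 𝒜 ℬ 𝒜≽ℬ ℬ≽𝒜 S S∈min)) ,
    λ {T} T∈min →
      image σ T , image-minimal ℬ 𝒜 ℬ≽𝒜 𝒜≽ℬ T T∈min , ≐-sym (image-involutive T)

-- Images of subsets in the quotient by θ_I.

module _ {X : Setoid 0ℓ 0ℓ} (I : Subset X) where

  ⟦_⟧/ : Subset X → Subset (Quotient I)
  ⟦ S ⟧/ = image (quotientMap I) S

  /-mono : ∀ S T → ⟦ S ⟧ ⊆ ⟦ ⟦ T ⟧/ ⟧ → ⟦ ⟦ S ⟧/ ⟧ ⊆ ⟦ ⟦ T ⟧/ ⟧
  /-mono S T S⊆T/ (_ , x∈S , xθy) = Subset.resp ⟦ T ⟧/ xθy (S⊆T/ x∈S)

  image-/ : ∀ (σ : Func (Quotient I) (Quotient I)) S T →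
            (∀ {x} → ⟦ S ⟧ x → ⟦ ⟦ T ⟧/ ⟧ (Func.to σ x)) →
            (∀ {x} → ⟦ T ⟧ x → ⟦ image σ ⟦ S ⟧/ ⟧ x) →
            ⟦ image σ ⟦ S ⟧/ ⟧ ≐ ⟦ ⟦ T ⟧/ ⟧
  image-/ σ S T S→T T→S =
    (λ (x , (z , z∈S , zθx) , σxθy) →
      Subset.resp ⟦ T ⟧/ (Setoid.trans (Quotient I) (Func.cong σ zθx) σxθy) (S→T z∈S)) ,
    λ (x , x∈T , xθy) → Subset.resp (image σ ⟦ S ⟧/) xθy (T→S x∈T)

-- The cyclic successor on residues.

private variable
  m : ℕ

toℕ-mod : ∀ n → toℕ (n mod suc m) ≡ n % suc m
toℕ-mod n = toℕ-fromℕ< _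

-- Eliminates `_mod_`: what follows on `next` is a case split on whether the successor wraps around,
-- which happens at the last residue.
toℕ-next : ∀ (p : Fin m) → (suc (toℕ p) < m × toℕ (next p) ≡ suc (toℕ p)) ⊎
                           (suc (toℕ p) ≡ m × toℕ (next p) ≡ 0)
toℕ-next {suc m} p with ℕ.m≤n⇒m<n∨m≡n (toℕ<n p)
... | inj₁ 1+p<m = inj₁ (1+p<m , trans (toℕ-mod (suc (toℕ p))) (m<n⇒m%n≡m 1+p<m))
... | inj₂ 1+p≡m = inj₂ (1+p≡m ,
  trans (toℕ-mod (suc (toℕ p)))
        (trans (cong (_% suc m) 1+p≡m) (n%n≡0 (suc m))))

next-injective : ∀ {p q : Fin m} → next p ≡ next q → p ≡ q
next-injective {p = p} {q} eq with toℕ-next p | toℕ-next q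
... | inj₁ (_ , a) | inj₁ (_ , b) =
  toℕ-injective (ℕ.suc-injective (trans (sym a) (trans (cong toℕ eq) b)))
... | inj₁ (_ , a) | inj₂ (_ , b) =
  contradiction (trans (sym a) (trans (cong toℕ eq) b)) λ ()
... | inj₂ (_ , a) | inj₁ (_ , b) =
  contradiction (trans (sym b) (trans (cong toℕ (sym eq)) a)) λ ()
... | inj₂ (a , _) | inj₂ (b , _) =
  toℕ-injective (ℕ.suc-injective (trans a (sym b)))

next≢ : 3 ≤ m → ∀ (p : Fin m) → next p ≢ p
next≢ m≥3 p eq with toℕ-next p
... | inj₁ (_ , a) = ℕ.1+n≢n (trans (sym a) (cong toℕ eq))
... | inj₂ (a , b) rewrite trans (sym (cong toℕ eq)) b =
  contradiction (subst (3 ≤_) (sym a) m≥3) λ { (s≤s ()) }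

-- Without wrap-around p + 2 = p is absurd; a wrap-around at either step would force m to be 1 or 2.
-- This guarantees that two residues are never successors of each other.
next∘next≢ : 3 ≤ m → ∀ (p : Fin m) → next (next p) ≢ p
next∘next≢ m≥3 p eq with toℕ-next p | toℕ-next (next p)
... | inj₁ (_ , a) | inj₁ (_ , b) =
  ℕ.m≢1+n+m (toℕ p) {1} (trans (sym (cong toℕ eq)) (trans b (cong suc a)))
... | inj₁ (_ , a) | inj₂ (b , c) rewrite a | trans (sym (cong toℕ eq)) c =
  contradiction (subst (3 ≤_) (sym b) m≥3) λ { (s≤s (s≤s ())) }
... | inj₂ (a , b) | inj₁ (_ , c) rewrite b | trans (sym (cong toℕ eq)) c =
  contradiction (subst (3 ≤_) (sym a) m≥3) λ { (s≤s (s≤s ())) }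
... | inj₂ (_ , b) | inj₂ (c , _) rewrite b =
  contradiction (subst (3 ≤_) (sym c) m≥3) λ { (s≤s ()) }

avoid₂ : 3 ≤ m → ∀ (a b : Fin m) → ∃[ c ] c ≢ a × c ≢ b
avoid₂ (s≤s (s≤s (s≤s z≤n))) = avoid

-- Symmetric difference with a singleton, and parity.

toggle : Fin m → Fin.Subset m → Fin.Subset m
toggle q J = updateAt J q not

toggle-involutive : ∀ (q : Fin m) J → toggle q (toggle q J) ≡ J
toggle-involutive q J =
  trans (updateAt-updateAt-local q J (not-involutive _)) (updateAt-id q J)

∈-toggle : ∀ (q : Fin m) {J} → q Fin.∈ J → q Fin.∉ toggle q J
∈-toggle q {J} q∈J q∈J′
  with () ← []=-injective q∈J′ (updateAt-updates q J q∈J)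

∉-toggle : ∀ (q : Fin m) {J} → q Fin.∉ J → q Fin.∈ toggle q J
∉-toggle zero    {Fin.outside ∷ J} _   = here
∉-toggle zero    {Fin.inside  ∷ J} q∉J = contradiction here q∉J
∉-toggle (suc q) {_ ∷ J}           q∉J = there (∉-toggle q (q∉J ∘ there))

parity-suc : ∀ n → parity (suc n) ≡ parity n ⁻¹
parity-suc n = sym (⁻¹-selfInverse (suc-homo-⁻¹ n))

parity-toggle : ∀ (q : Fin m) J → parity Fin.∣ toggle q J ∣ ≡ parity Fin.∣ J ∣ ⁻¹
parity-toggle zero    (Fin.outside ∷ J) = parity-suc Fin.∣ J ∣
parity-toggle zero    (Fin.inside  ∷ J) = sym (suc-homo-⁻¹ Fin.∣ J ∣)
parity-toggle (suc q) (Fin.outside ∷ J) = parity-toggle q J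
parity-toggle (suc q) (Fin.inside  ∷ J) = begin
  parity (suc Fin.∣ toggle q J ∣)  ≡⟨ parity-suc Fin.∣ toggle q J ∣ ⟩
  parity Fin.∣ toggle q J ∣ ⁻¹     ≡⟨ cong _⁻¹ (parity-toggle q J) ⟩
  parity Fin.∣ J ∣ ⁻¹ ⁻¹           ≡⟨ cong _⁻¹ (parity-suc Fin.∣ J ∣) ⟨
  parity (suc Fin.∣ J ∣) ⁻¹        ∎
  where
  open ≡-Reasoning

-- The exchange of q and q′.

index : E m → Fin m
index = [ id , id ]

swapAt : Fin m → E m → E m
swapAt q e = if does (index e ≟ q) then Sum.swap e else e

swapAt-fixes : ∀ {q : Fin m} e → index e ≢ q → swapAt q e ≡ e
swapAt-fixes {q = q} e e≢q with index e ≟ q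
... | yes e≡q = contradiction e≡q e≢q
... | no  _   = refl

index-swapAt : ∀ (q : Fin m) e → index (swapAt q e) ≡ index e
index-swapAt q e with index e ≟ q
index-swapAt q (inj₁ _) | yes _ = refl
index-swapAt q (inj₂ _) | yes _ = refl
index-swapAt q e        | no  _ = refl

swapAt-swaps : ∀ {q : Fin m} e → index e ≡ q → swapAt q e ≡ Sum.swap e
swapAt-swaps {q = q} e e≡q with index e ≟ q
... | yes _   = refl
... | no  e≢q = contradiction e≡q e≢q

swapAt-involutive : ∀ (q : Fin m) e → swapAt q (swapAt q e) ≡ e
swapAt-involutive q e with index e ≟ q
swapAt-involutive q (inj₁ n) | yes n≡q = swapAt-swaps (inj₂ n) n≡q
swapAt-involutive q (inj₂ n) | yes n≡q = swapAt-swaps (inj₁ n) n≡q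
swapAt-involutive q e        | no  e≢q = swapAt-fixes e e≢q

-- Only n and n′ have index n, so two distinct elements of that index exhaust it.
same-index : ∀ {e f g : E m} → e ≢ f → index e ≡ index f → index g ≡ index e → g ≡ e ⊎ g ≡ f
same-index {e = inj₁ _} {inj₁ _} e≢f refl refl = contradiction refl e≢f
same-index {e = inj₂ _} {inj₂ _} e≢f refl refl = contradiction refl e≢f
same-index {e = inj₁ _} {inj₂ _} {inj₁ _} _ refl refl = inj₁ refl
same-index {e = inj₁ _} {inj₂ _} {inj₂ _} _ refl refl = inj₂ refl
same-index {e = inj₂ _} {inj₁ _} {inj₁ _} _ refl refl = inj₂ refl
same-index {e = inj₂ _} {inj₁ _} {inj₂ _} _ refl refl = inj₁ refl

-- The blocks F_J.

F-swapAt : ∀ (q : Fin m) J e → ⟦ F J ⟧ e → ⟦ F (toggle q J) ⟧ (swapAt q e)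
F-swapAt q J e e∈F with index e ≟ q
F-swapAt q J (inj₁ _) q∈J | yes refl = ∈-toggle q q∈J
F-swapAt q J (inj₂ _) q∉J | yes refl = ∉-toggle q q∉J
F-swapAt q J (inj₁ n) n∈J | no n≢q   = updateAt-minimal n q J n≢q n∈J
-- `updateAt-minimal` only carries membership forward; toggling a second time restores J and so
-- refutes membership in `toggle q J`.
F-swapAt q J (inj₂ n) n∉J | no n≢q   = λ n∈J′ →
  n∉J (subst (n Fin.∈_) (toggle-involutive q J) (updateAt-minimal n q (toggle q J) n≢q n∈J′))

-- F_J picks one element from each pair n, n′. Hence a block F_J through e has no other element of
-- the same index.
F-index-injective : ∀ (J : Fin.Subset m) e f → ⟦ F J ⟧ e → ⟦ F J ⟧ f → index e ≡ index f → e ≡ f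
F-index-injective J (inj₁ _) (inj₁ _) _   _   refl = refl
F-index-injective J (inj₂ _) (inj₂ _) _   _   refl = refl
F-index-injective J (inj₁ _) (inj₂ _) n∈J n∉J refl = contradiction n∈J n∉J
F-index-injective J (inj₂ _) (inj₁ _) n∉J n∈J refl = contradiction n∈J n∉J

F-through : ∀ (e : E m) q → index e ≢ q → ∃[ J ] ⟦ F J ⟧ e × q Fin.∈ J
F-through (inj₁ p) q _   =
  Fin.⁅ p ⁆ Fin.∪ Fin.⁅ q ⁆ ,
  Fin.p⊆p∪q Fin.⁅ q ⁆ (Fin.x∈⁅x⁆ p) , Fin.q⊆p∪q Fin.⁅ p ⁆ Fin.⁅ q ⁆ (Fin.x∈⁅x⁆ q)
F-through (inj₂ p) q p≢q = Fin.⁅ q ⁆ , Fin.x≢y⇒x∉⁅y⁆ p≢q , Fin.x∈⁅x⁆ q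

≢⇒≡⁻¹ : ∀ {π ρ} → π ≢ ρ → π ⁻¹ ≡ ρ
≢⇒≡⁻¹ {0ℙ} {0ℙ} π≢ρ = contradiction refl π≢ρ
≢⇒≡⁻¹ {0ℙ} {1ℙ} _   = refl
≢⇒≡⁻¹ {1ℙ} {0ℙ} _   = refl
≢⇒≡⁻¹ {1ℙ} {1ℙ} π≢ρ = contradiction refl π≢ρ

-- If the J at hand has the wrong parity, toggle a third residue c, available as m ≥ 3. This affects
-- neither the membership of e in F_J nor that of q in J.
F-through-parity : 3 ≤ m → ∀ π (e : E m) q → index e ≢ q →
                   ∃[ J ] parity Fin.∣ J ∣ ≡ π × ⟦ F J ⟧ e × q Fin.∈ J
F-through-parity m≥3 π e q e≢q with F-through e q e≢q | avoid₂ m≥3 (index e) q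
... | J , e∈F , q∈J | c , c≢e , c≢q with parity Fin.∣ J ∣ ℙ.≟ π
...   | yes J≡π = J , J≡π , e∈F , q∈J
...   | no  J≢π =
  toggle c J , trans (parity-toggle c J) (≢⇒≡⁻¹ J≢π) ,
  subst ⟦ F (toggle c J) ⟧ (swapAt-fixes e (c≢e ∘ sym)) (F-swapAt c J e e∈F) ,
  updateAt-minimal q c J (c≢q ∘ sym) q∈J

-- The blocks G_p.

G-index : ∀ {p : Fin m} e → index e ≢ p → index e ≢ next p → ⟦ G p ⟧ e
G-index e e≢p e≢p+1 = (λ { refl → e≢p refl }) , (λ { refl → e≢p refl }) , λ { refl → e≢p+1 refl }

G-index≢ : ∀ {r : Fin m} e → ⟦ G r ⟧ e → index e ≢ r
G-index≢ (inj₁ _) (≢r , _)      refl = ≢r refl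
G-index≢ (inj₂ _) (_ , ≢r′ , _) refl = ≢r′ refl

-- For r ≠ p, G_r contains both or neither of p + 1 and (p + 1)′: neither if r = p + 1, and both
-- otherwise, since injectivity of `next` gives r + 1 ≠ p + 1.
G-swapAt : ∀ {p r : Fin m} → r ≢ p → ∀ e → ⟦ G r ⟧ e → ⟦ G r ⟧ (swapAt (next p) e)
G-swapAt {p = p} {r} r≢p e e∈G with index e ≟ next p | index-swapAt (next p) e
... | no  _     | _    = e∈G
... | yes e≡p+1 | e′≡e = G-index (Sum.swap e)
  (λ e′≡r → G-index≢ e e∈G (trans (sym e′≡e) e′≡r))
  (λ e′≡r+1 → r≢p (next-injective (trans (sym e′≡r+1) (trans e′≡e e≡p+1))))

-- Of the three elements missing from G_p, the index condition rules out p and p′, and p + 1 in J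
-- rules out (p + 1)′.
F⇒G : ∀ {p : Fin m} {J} → next p Fin.∈ J → ∀ e → index e ≢ p → ⟦ F J ⟧ e → ⟦ G p ⟧ e
F⇒G p+1∈J (inj₁ _) e≢p _   = (λ { refl → e≢p refl }) , (λ ()) , λ ()
F⇒G p+1∈J (inj₂ _) e≢p n∉J = (λ ()) , (λ { refl → e≢p refl }) , λ { refl → n∉J p+1∈J }

-- The exchange on the contracted systems.

module _ (m≥3 : 3 ≤ m) (I : Subset (setoid (Maybe (E m)))) where

  private
    /_ : Subset (setoid (E m)) → Subset (Quotient I)
    / S = ⟦_⟧/ I (S ∪0)

    𝒰/ : Parity → SetSystem (Quotient I)
    𝒰/ π = imageSystem (quotientMap I) (system (adjoin0 (ℳ m≥3 π)))

  F∈𝒰/ : ∀ {π} J {T} → parity Fin.∣ J ∣ ≡ π → ⟦ T ⟧ ≐ ⟦ / F J ⟧ → Block (𝒰/ π) T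
  F∈𝒰/ J J≡π T≐F =
    F J ∪0 , (F J , inj₁ (lift ((J , J≡π) , ≐-refl)) , ≐-refl) , T≐F

  G∈𝒰/ : ∀ {π} r {T} → ⟦ T ⟧ ≐ ⟦ / G r ⟧ → Block (𝒰/ π) T
  G∈𝒰/ r T≐G = G r ∪0 , (G r , inj₂ (lift (r , ≐-refl)) , ≐-refl) , T≐G

  -- An inclusion is enough here, since `Dominates` asks only for some block below T.
  𝒰/⊇ : ∀ {π} T → Block (𝒰/ π) T →
        (∃[ J ] parity Fin.∣ J ∣ ≡ π × ⟦ / F J ⟧ ⊆ ⟦ T ⟧) ⊎ (∃[ r ] ⟦ / G r ⟧ ⊆ ⟦ T ⟧)
  𝒰/⊇ T (R , (S , S∈ℳ , _ , S∪0⊆R) , _ , R/⊆T) = Sum.map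
    (λ (lift ((J , J≡π) , _ , F⊆S)) → J , J≡π , λ {x} → sub (F J) F⊆S {x})
    (λ (lift (r , _ , G⊆S)) → r , λ {x} → sub (G r) G⊆S {x}) S∈ℳ
    where
    sub : ∀ Q → ⟦ Q ⟧ ⊆ ⟦ S ⟧ → ⟦ / Q ⟧ ⊆ ⟦ T ⟧
    sub Q Q⊆S (x , x∈Q , xθy) = R/⊆T (x , S∪0⊆R {x} (∪0-mono Q S Q⊆S {x} x∈Q) , xθy)

  module _ (q : Fin m) (preserves : ∀ {x} → ⟦ I ⟧ x → ⟦ I ⟧ (Maybe.map (swapAt q) x)) where

    swap/ : Func (Quotient I) (Quotient I)
    swap/ = record
      { to   = Maybe.map (swapAt q)
      ; cong = Sum.map (cong _) (λ (x∈I , y∈I) → preserves x∈I , preserves y∈I)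
      }

    swap-involutive : ∀ x → Maybe.map (swapAt q) (Maybe.map (swapAt q) x) ≡ x
    swap-involutive nothing  = refl
    swap-involutive (just e) = cong just (swapAt-involutive q e)

    image-swap/ : ∀ S T → (∀ e → ⟦ S ⟧ e → ⟦ T ⟧ (swapAt q e)) →
                  (∀ e → ⟦ T ⟧ e → ⟦ S ⟧ (swapAt q e)) → ⟦ image swap/ (/ S) ⟧ ≐ ⟦ / T ⟧
    image-swap/ S T S→T T→S = image-/ I swap/ (S ∪0) (T ∪0)
      (λ {x} x∈S → Maybe.map (swapAt q) x , ∪0-map S T S→T x x∈S , inj₁ refl)
      (λ {x} x∈T → Maybe.map (swapAt q) x ,
        (Maybe.map (swapAt q) x , ∪0-map T S T→S x x∈T , inj₁ refl) ,
        inj₁ (swap-involutive x))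
      where
      ∪0-map : ∀ S T → (∀ e → ⟦ S ⟧ e → ⟦ T ⟧ (swapAt q e)) →
               ∀ x → ⟦ S ∪0 ⟧ x → ⟦ T ∪0 ⟧ (Maybe.map (swapAt q) x)
      ∪0-map _ _ S→T nothing  _   = tt
      ∪0-map _ _ S→T (just e) e∈S = S→T e e∈S

    -- G_r occurs in both systems. If its contraction is not fixed by the exchange, it therefore
    -- needs a contracted F_J below it in each parity, one for each direction of domination.
    G-harmless : Fin m → Set
    G-harmless r = ⟦ image swap/ (/ G r) ⟧ ≐ ⟦ / G r ⟧ ⊎
                   (∀ π → ∃[ J ] parity Fin.∣ J ∣ ≡ π × ⟦ / F J ⟧ ⊆ ⟦ / G r ⟧)

    dominates : (∀ r → G-harmless r) → ∀ π ρ → π ⁻¹ ≡ ρ →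
                Dominates swap/ (inj₁ ∘ swap-involutive) (𝒰/ π) (𝒰/ ρ)
    dominates harmless π _ refl T T∈𝒰 = [ F-case , G-case ] (𝒰/⊇ T T∈𝒰)
      where
      F-case : (∃[ J ] parity Fin.∣ J ∣ ≡ π × ⟦ / F J ⟧ ⊆ ⟦ T ⟧) → _
      F-case (J , J≡π , F⊆T) =
        / F J , F∈𝒰/ J {/ F J} J≡π ≐-refl , (λ {x} → F⊆T {x}) ,
        F∈𝒰/ (toggle q J) {image swap/ (/ F J)} (trans (parity-toggle q J) (cong _⁻¹ J≡π))
          (image-swap/ (F J) (F (toggle q J)) (F-swapAt q J)
            (λ e e∈F → subst (λ K → ⟦ F K ⟧ (swapAt q e)) (toggle-involutive q J)
                             (F-swapAt q (toggle q J) e e∈F)))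

      G-case : (∃[ r ] ⟦ / G r ⟧ ⊆ ⟦ T ⟧) → _
      G-case (r , G⊆T) with harmless r
      ... | inj₁ fixed =
        / G r , G∈𝒰/ r {/ G r} ≐-refl , (λ {x} → G⊆T {x}) , G∈𝒰/ r {image swap/ (/ G r)} fixed
      ... | inj₂ covers with covers π
      -- G_r is bypassed: the F_J below it also lies below T and is sent to a block of the opposite
      -- parity.
      ...   | J , J≡π , F⊆G = F-case (J , J≡π , λ {x} x∈F → G⊆T {x} (F⊆G x∈F))

    contract-≅ : (∀ r → G-harmless r) →
                 system (contract (𝒰₁ m≥3) I) ≅ system (contract (𝒰₂ m≥3) I)
    contract-≅ harmless = minimal-≅ swap/ (inj₁ ∘ swap-involutive) (𝒰/ 1ℙ) (𝒰/ 0ℙ)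
      (dominates harmless 1ℙ 0ℙ refl) (dominates harmless 0ℙ 1ℙ refl)

  -- The two kinds of pairs I.

  complementary-≅ : ∀ {e f} → e ≢ f → index e ≡ index f →
                    ⟦ I ⟧ ≐ (λ x → x ≡ just e ⊎ x ≡ just f) →
                    system (contract (𝒰₁ m≥3) I) ≅ system (contract (𝒰₂ m≥3) I)
  complementary-≅ {e} {f} e≢f e≡f (I⊆ , ⊆I) = contract-≅ q preserves harmless
    where
    q = index e

    ∈I : ∀ {g} → index g ≡ q → ⟦ I ⟧ (just g)
    ∈I g≡q = ⊆I (Sum.map (cong just) (cong just) (same-index e≢f e≡f g≡q))

    swap∈I : ∀ g → index g ≡ q → ⟦ I ⟧ (just (swapAt q g))
    swap∈I g g≡q = ∈I (trans (index-swapAt q g) g≡q)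

    preserves : ∀ {x} → ⟦ I ⟧ x → ⟦ I ⟧ (Maybe.map (swapAt q) x)
    preserves x∈I with I⊆ x∈I
    ... | inj₁ refl = swap∈I e refl
    ... | inj₂ refl = swap∈I f (sym e≡f)

    -- The exchange moves only elements of index q, and these all lie in the single class I. Thus
    -- every G_r is fixed modulo θ_I.
    swapθ : ∀ x → θ I (Maybe.map (swapAt q) x) x
    swapθ nothing  = inj₁ refl
    swapθ (just g) with index g ≟ q
    ... | yes g≡q = inj₂ (subst (⟦ I ⟧ ∘ just) (swapAt-swaps g g≡q) (swap∈I g g≡q) , ∈I g≡q)
    ... | no  _   = inj₁ refl

    harmless : ∀ r → G-harmless q preserves r
    harmless r = inj₁ (image-/ I (swap/ q preserves) (G r ∪0) (G r ∪0)
      (λ {x} x∈G → x , x∈G , Setoid.sym (Quotient I) (swapθ x))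
      (λ {x} x∈G → x , (x , x∈G , inj₁ refl) , swapθ x))

  -- `y` ranges over `Maybe (E m)` to include the element 0, which has no index and satisfies both
  -- inequalities trivially. They place `y` in `G p ∪0` and make the exchange at p + 1 fix it; e is
  -- fixed too, so I is preserved.
  transversal-≅ : ∀ e y → Maybe.map index y ≢ just (index e) →
                  Maybe.map index y ≢ just (next (index e)) →
                  ⟦ I ⟧ ≐ (λ x → x ≡ just e ⊎ x ≡ y) →
                  system (contract (𝒰₁ m≥3) I) ≅ system (contract (𝒰₂ m≥3) I)
  transversal-≅ e y y≢p y≢q (I⊆ , ⊆I) = contract-≅ q preserves harmless
    where
    p = index e
    q = next p

    p≢q : p ≢ q
    p≢q = next≢ m≥3 p ∘ sym

    fixes : ∀ x → Maybe.map index x ≢ just q → Maybe.map (swapAt q) x ≡ x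
    fixes nothing  _   = refl
    fixes (just g) g≢q = cong just (swapAt-fixes g (g≢q ∘ cong just))

    preserves : ∀ {x} → ⟦ I ⟧ x → ⟦ I ⟧ (Maybe.map (swapAt q) x)
    preserves {x} x∈I with I⊆ x∈I
    ... | inj₁ refl = subst ⟦ I ⟧ (sym (fixes (just e) (p≢q ∘ just-injective))) x∈I
    ... | inj₂ refl = subst ⟦ I ⟧ (sym (fixes x y≢q)) x∈I

    G∋ : ∀ x → Maybe.map index x ≢ just p → Maybe.map index x ≢ just q → ⟦ G p ∪0 ⟧ x
    G∋ nothing  _   _   = tt
    G∋ (just g) g≢p g≢q = G-index g (g≢p ∘ cong just) (g≢q ∘ cong just)

    harmless : ∀ r → G-harmless q preserves r
    harmless r with r ≟ p
    ... | no  r≢p  = inj₁ (image-swap/ q preserves (G r) (G r) (G-swapAt r≢p) (G-swapAt r≢p))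
    ... | yes refl = inj₂ covers
      where
      covers : ∀ π → ∃[ J ] parity Fin.∣ J ∣ ≡ π × ⟦ / F J ⟧ ⊆ ⟦ / G p ⟧
      covers π with F-through-parity m≥3 π e q p≢q
      ... | J , J≡π , e∈F , q∈J = J , J≡π , /-mono I (F J ∪0) (G p ∪0) (λ {x} → F⊆G/ x)
        where
        F⊆G/ : ∀ x → ⟦ F J ∪0 ⟧ x → ⟦ / G p ⟧ x
        F⊆G/ nothing  _   = nothing , tt , inj₁ refl
        F⊆G/ (just g) g∈F with index g ≟ p
        ... | no  g≢p = just g , F⇒G q∈J g g≢p g∈F , inj₁ refl
        -- The only element of F_J of index p is e itself, and its class is represented by `y`,
        -- which lies in `G p ∪0`.
        ... | yes g≡p with refl ← F-index-injective J g e g∈F e∈F g≡p =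
          y , G∋ y y≢p y≢q , inj₂ (⊆I (inj₂ refl) , ⊆I (inj₁ refl))

proposition3p19 : (m : ℕ) (m≥3 : 3 ≤ m) → StronglyHypomorphic (𝒰₁ m≥3) (𝒰₂ m≥3)
proposition3p19 m m≥3 I (nothing , nothing , a≢b , _) = contradiction refl a≢b
proposition3p19 m m≥3 I (just e , nothing , _ , I≐) = transversal-≅ m≥3 I e nothing (λ ()) (λ ()) I≐
proposition3p19 m m≥3 I (nothing , just e , _ , I⊆ , ⊆I) =
  transversal-≅ m≥3 I e nothing (λ ()) (λ ()) (Sum.swap ∘ I⊆ , ⊆I ∘ Sum.swap)
proposition3p19 m m≥3 I (just e , just f , e≢f , I≐@(I⊆ , ⊆I)) with index e ≟ index f
... | yes e≡f = complementary-≅ m≥3 I (e≢f ∘ cong just) e≡f I≐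
... | no  e≢f′ with index f ≟ next (index e)
...   | no  f≢e+1 =
  transversal-≅ m≥3 I e (just f) (e≢f′ ∘ sym ∘ just-injective) (f≢e+1 ∘ just-injective) I≐
-- Here f has the index following that of e, so e cannot serve as x. The roles are exchanged: by
-- `next∘next≢` the index of e does not follow that of f.
...   | yes f≡e+1 =
  transversal-≅ m≥3 I f (just e) (e≢f′ ∘ just-injective)
    (λ e≡f+1 → next∘next≢ m≥3 (index e)
      (trans (cong next (sym f≡e+1)) (sym (just-injective e≡f+1))))
    (Sum.swap ∘ I⊆ , ⊆I ∘ Sum.swap)
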